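{- Let $k$ be a fixed positive integer. In the "all violated constraints" model, there is an algorithm which, for an arbitrary hidden $k$SAT instance on $n$ variables and $m$ clauses, either learns the instance (that is, determines for every clause index $j\in[m]$ the set of literals of the clause $C_j$) or else finds a satisfying assignment of the instance, in time $O(mn^k)$, where the constant hidden in the $O$-notation depends only on $k$.
   Context: A SAT formula on Boolean variables $x_1,\dots,x_n$ is a conjunction of clauses $C_1,\dots,C_m$; each clause is a disjunction of literals ($x_i$ or $\overline{x}_i$) on pairwise distinct variables. It is a $k$SAT instance if every clause has at most $k$ literals. Clauses with the same set of literals may occur several times. "All violated constraints" model: the formula is hidden, and the algorithm accesses it only through an oracle. A query is an assignment $\mathbf{x}\in\{0,1\}^n$, and the oracle returns the set of indices $j\in[m]$ of all clauses $C_j$ violated (evaluated to $0$) by $\mathbf{x}$; in particular, if this set is empty then $\mathbf{x}$ is a satisfying assignment. Running time is total running time, with each oracle query costing unit time. -}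

module Defs where

open import Data.Bool using (Bool; true; false; not; _∧_; if_then_else_)
open import Data.Bool.ListAction using (any)
open import Data.Fin using (Fin; toℕ; fromℕ<)
open import Data.Fin.Subset using (Subset)
open import Data.List using (List; length; map)
open import Data.List.Membership.Propositional using (_∈_)
open import Data.List.Relation.Unary.Unique.Propositional using (Unique)
open import Data.Nat using (ℕ; zero; suc; pred; _+_; _≤_; _≡ᵇ_; _<ᵇ_; _<?_)
open import Data.Product using (_×_; _,_; proj₁)
open import Data.Sum using (_⊎_)
open import Data.Vec using (tabulate; lookup)
open import Function using (_⇔_)
open import Relation.Binary.PropositionalEquality using (_≡_)
open import Relation.Nullary using (yes; no)

------------------------------------------------------------------------
-- SAT

-- (i , true) is the literal x_i and (i , false) is its negation.
Literal : ℕ → Set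
Literal n = Fin n × Bool

record Clause (n : ℕ) : Set where
  constructor mkClause
  field
    literals : List (Literal n)
    distinct : Unique (map proj₁ literals)

open Clause public

Formula : ℕ → ℕ → Set
Formula n m = Fin m → Clause n

IsKSAT : ∀ {n m} → ℕ → Formula n m → Set
IsKSAT k φ = ∀ j → length (literals (φ j)) ≤ k

Assignment : ℕ → Set
Assignment n = Fin n → Bool

evalLiteral : ∀ {n} → Assignment n → Literal n → Bool
evalLiteral x (i , b) = if b then x i else not (x i)

evalClause : ∀ {n} → Assignment n → Clause n → Bool
evalClause x C = any (evalLiteral x) (literals C)

Satisfies : ∀ {n m} → Assignment n → Formula n m → Set
Satisfies x φ = ∀ j → evalClause x (φ j) ≡ true

Oracle : ℕ → ℕ → Set
Oracle n m = Assignment n → Subset m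

allViolated : ∀ {n m} → Formula n m → Oracle n m
allViolated φ x = tabulate λ j → not (evalClause x (φ j))

------------------------------------------------------------------------
-- Oracle programs
--
-- A unit-cost imperative language over natural numbers with finitely many
-- scalar variables and zero-initialised two-dimensional tables per program.
-- Arithmetic is limited to successor, predecessor and comparison, so the
-- numbers occurring in a run are bounded by the inputs, the constants of the
-- program and the elapsed time; unit cost therefore hides no large-number
-- arithmetic.

Var Table : Set
Var   = ℕ
Table = ℕ

data Expr : Set where
  const       : ℕ → Expr
  var         : Var → Expr
  inc dec     : Expr → Expr
  equal less  : Expr → Expr → Expr
  _[_,_]      : Table → Expr → Expr → Expr

infixr 4 _⨾_
infix  5 _≔_ _[_,_]≔_

data Program : Set where
  skip      : Program
  _≔_       : Var → Expr → Program
  _[_,_]≔_  : Table → Expr → Expr → Expr → Program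
  query     : Program
  _⨾_       : Program → Program → Program
  ifte      : Expr → Program → Program → Program
  while     : Expr → Program → Program

record State : Set where
  constructor mkState
  field
    vars   : Var → ℕ
    tables : Table → ℕ → ℕ → ℕ

open State public

-- Input and output conventions.  The assignment to be queried and the
-- oracle's answer occupy row 0 of their tables.  Everything not named here
-- is working memory.
varN varM verdict : Var
varN    = 0
varM    = 1
verdict = 2

assignmentTable answerTable : Table
assignmentTable = 0
answerTable     = 1

-- Entry (j , i) of literalTable b records whether the literal (i , b) is
-- in clause j.
literalTable : Bool → Table
literalTable true  = 2
literalTable false = 3

bit : Bool → ℕ
bit true  = 1
bit false = 0

isSet : ℕ → Bool
isSet zero    = false
isSet (suc _) = true

setVar : Var → ℕ → State → State
setVar x v σ = mkState (λ y → if y ≡ᵇ x then v else vars σ y) (tables σ)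

setCell : Table → ℕ → ℕ → ℕ → State → State
setCell T r c v σ = mkState (vars σ) λ T′ r′ c′ →
  if (T′ ≡ᵇ T) ∧ (r′ ≡ᵇ r) ∧ (c′ ≡ᵇ c) then v else tables σ T′ r′ c′

currentAssignment : ∀ n → State → Assignment n
currentAssignment n σ i = isSet (tables σ assignmentTable 0 (toℕ i))

memberBit : ∀ {m} → Subset m → ℕ → ℕ
memberBit {m} S j with j <? m
... | yes j<m = bit (lookup S (fromℕ< j<m))
... | no  _   = 0

setAnswer : ∀ {m} → Subset m → State → State
setAnswer S σ = mkState (vars σ) λ T r c →
  if (T ≡ᵇ answerTable) ∧ (r ≡ᵇ 0) then memberBit S c else tables σ T r c

initial : ℕ → ℕ → State
initial n m = setVar varN n (setVar varM m (mkState (λ _ → 0) (λ _ _ _ → 0)))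

eval : State → Expr → ℕ
eval σ (const v)     = v
eval σ (var x)       = vars σ x
eval σ (inc e)       = suc (eval σ e)
eval σ (dec e)       = pred (eval σ e)
eval σ (equal e f)   = bit (eval σ e ≡ᵇ eval σ f)
eval σ (less e f)    = bit (eval σ e <ᵇ eval σ f)
eval σ (T [ e , f ]) = tables σ T (eval σ e) (eval σ f)

cost : Expr → ℕ
cost (const _)     = 1
cost (var _)       = 1
cost (inc e)       = suc (cost e)
cost (dec e)       = suc (cost e)
cost (equal e f)   = suc (cost e + cost f)
cost (less e f)    = suc (cost e + cost f)
cost (_ [ e , f ]) = suc (cost e + cost f)

-- O ⊢ p , σ ⇓[ t ] τ : with oracle O, the program p started in σ halts in τ
-- after time t.  The relation is deterministic: at most one rule applies to
-- any p and σ.  The oracle is accessible only through query.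
infix 3 _⊢_,_⇓[_]_

data _⊢_,_⇓[_]_ {n m} (O : Oracle n m) :
       Program → State → ℕ → State → Set where

  ⇓skip : ∀ {σ} → O ⊢ skip , σ ⇓[ 1 ] σ

  ⇓var : ∀ {σ x e} →
    O ⊢ x ≔ e , σ ⇓[ suc (cost e) ] setVar x (eval σ e) σ

  ⇓cell : ∀ {σ T r c e} →
    O ⊢ T [ r , c ]≔ e , σ ⇓[ suc (cost r + cost c + cost e) ]
      setCell T (eval σ r) (eval σ c) (eval σ e) σ

  ⇓query : ∀ {σ} →
    O ⊢ query , σ ⇓[ 1 ] setAnswer (O (currentAssignment n σ)) σ

  ⇓seq : ∀ {p q ρ σ τ s t} →
    O ⊢ p , ρ ⇓[ s ] σ → O ⊢ q , σ ⇓[ t ] τ →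
    O ⊢ p ⨾ q , ρ ⇓[ s + t ] τ

  ⇓then : ∀ {e p q σ τ t} →
    isSet (eval σ e) ≡ true → O ⊢ p , σ ⇓[ t ] τ →
    O ⊢ ifte e p q , σ ⇓[ suc (cost e + t) ] τ

  ⇓else : ∀ {e p q σ τ t} →
    isSet (eval σ e) ≡ false → O ⊢ q , σ ⇓[ t ] τ →
    O ⊢ ifte e p q , σ ⇓[ suc (cost e + t) ] τ

  ⇓stop : ∀ {e p σ} →
    isSet (eval σ e) ≡ false →
    O ⊢ while e p , σ ⇓[ suc (cost e) ] σ

  ⇓loop : ∀ {e p ρ σ τ s t} →
    isSet (eval ρ e) ≡ true → O ⊢ p , ρ ⇓[ s ] σ → O ⊢ while e p , σ ⇓[ t ] τ →
    O ⊢ while e p , ρ ⇓[ suc (cost e + (s + t)) ] τ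

------------------------------------------------------------------------
-- Outcomes

Learned : ∀ {n m} → Formula n m → State → Set
Learned φ σ = ∀ j i b →
  (isSet (tables σ (literalTable b) (toℕ j) (toℕ i)) ≡ true)
    ⇔ ((i , b) ∈ literals (φ j))

-- The verdict tells which of the two outcomes the program claims.
LearnsOrSatisfies : ∀ {n m} → Formula n m → State → Set
LearnsOrSatisfies {n} φ σ =
    (vars σ verdict ≡ 0 × Learned φ σ)
  ⊎ (vars σ verdict ≡ 1 × Satisfies (currentAssignment n σ) φ)

{-# OPTIONS --safe #-}
module Submission where

-- Every clause can be learned.  A literal (i , b) of C is detected by two
-- assignments that differ only at i, the one with value b at i satisfying C and
-- the other violating it.  Such a pair exists: set to true exactly the variables
-- of the other negative literals of C, at most k − 1 many.  So it suffices to
-- run, for every clause, through all k-tuples consisting of i and of k − 1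
-- variables set to true; each tuple takes constant time, provided that only the
-- entries touched are reset afterwards.

open import Defs
open import Data.Bool using (Bool; true; false; not; _∧_; _∨_; if_then_else_)
open import Data.Bool.ListAction using (any)
open import Data.Bool.Properties using (T-≡; ¬-not) renaming (_≟_ to _≟ᴮ_)
open import Data.Fin using (Fin; toℕ; fromℕ<)
open import Data.Fin.Properties using (toℕ-injective; toℕ<n; fromℕ<-toℕ)
  renaming (_≟_ to _≟ᶠ_)
open import Data.List using (List; []; _∷_; length; map; filter)
open import Data.List.Membership.Propositional using (_∈_; lose)
open import Data.List.Membership.Propositional.Properties using (∈-map⁺; ∈-map⁻; ∈-filter⁺; ∈-filter⁻)
open import Data.List.Properties using (length-map; filter-notAll)
open import Data.List.Relation.Unary.All as All using ()
open import Data.List.Relation.Unary.AllPairs using (_∷_)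
open import Data.List.Relation.Unary.Any using (here; there)
open import Data.List.Relation.Unary.Unique.Propositional using (Unique)
open import Data.Nat using
  (ℕ; zero; suc; _+_; _*_; _^_; _≤_; _<_; _≡ᵇ_; _<ᵇ_; _<?_; z≤n; s≤s; s≤s⁻¹)
open import Data.Nat.Properties
open import Data.Nat.Solver using (module +-*-Solver)
open import Data.Product using (Σ-syntax; ∃-syntax; _×_; _,_; proj₁; proj₂)
open import Data.Sum using (_⊎_; inj₁; inj₂)
open import Data.Vec.Properties using (lookup∘tabulate)
open import Function using (_∘_; Equivalence; mk⇔)
open import Relation.Binary.PropositionalEquality hiding ([_])
open import Relation.Nullary using (¬_; yes; no; contradiction; ¬?; _×-dec_)
open import Relation.Unary using (Decidable)

-- Boolean tests and variable updates

≡ᵇ-true : ∀ {a b} → (a ≡ᵇ b) ≡ true → a ≡ b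
≡ᵇ-true {a} {b} eq = ≡ᵇ⇒≡ a b (Equivalence.from T-≡ eq)

≡ᵇ-refl : ∀ a → (a ≡ᵇ a) ≡ true
≡ᵇ-refl a = Equivalence.to T-≡ (≡⇒≡ᵇ a a refl)

≡ᵇ-false : ∀ {a b} → a ≢ b → (a ≡ᵇ b) ≡ false
≡ᵇ-false {a} {b} a≢b = ¬-not (a≢b ∘ ≡ᵇ-true)

isSet-bit : ∀ b → isSet (bit b) ≡ b
isSet-bit true  = refl
isSet-bit false = refl

<ᵇ-true : ∀ {a b} → a < b → (a <ᵇ b) ≡ true
<ᵇ-true = Equivalence.to T-≡ ∘ <⇒<ᵇ

<ᵇ-irrefl : ∀ a → (a <ᵇ a) ≡ false
<ᵇ-irrefl a = ¬-not λ eq → <-irrefl refl (<ᵇ⇒< a a (Equivalence.from T-≡ eq))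

setVar-same : ∀ x v σ → vars (setVar x v σ) x ≡ v
setVar-same x v σ rewrite ≡ᵇ-refl x = refl

setVar-other : ∀ {x y} v σ → y ≢ x → vars (setVar x v σ) y ≡ vars σ y
setVar-other v σ y≢x rewrite ≡ᵇ-false y≢x = refl

-- Clauses

any-true : ∀ {A : Set} (p : A → Bool) {xs x} → x ∈ xs → p x ≡ true → any p xs ≡ true
any-true p (here refl) px rewrite px = refl
any-true p {y ∷ _} (there x∈) px with p y
... | true  = refl
... | false = any-true p x∈ px

any-false : ∀ {A : Set} (p : A → Bool) xs → (∀ {x} → x ∈ xs → p x ≡ false) → any p xs ≡ false
any-false p []       none = refl
any-false p (x ∷ xs) none rewrite none (here refl) = any-false p xs (none ∘ there)

any-witness : ∀ {A : Set} (p : A → Bool) xs → any p xs ≡ true → ∃[ x ] (x ∈ xs × p x ≡ true)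
any-witness p (x ∷ xs) eq with p x in px
... | true = x , here refl , px
... | false with any-witness p xs eq
...   | y , y∈ , py = y , there y∈ , py

evalLiteral-cong : ∀ {n} {x y : Assignment n} i b → x i ≡ y i → evalLiteral x (i , b) ≡ evalLiteral y (i , b)
evalLiteral-cong i true  eq = eq
evalLiteral-cong i false eq = cong not eq

evalClause-cong : ∀ {n} {x y : Assignment n} (C : Clause n) → (∀ i → x i ≡ y i) →
  evalClause x C ≡ evalClause y C
evalClause-cong {x = x} {y} C x≗y = go (literals C)
  where
  go : ∀ ls → any (evalLiteral x) ls ≡ any (evalLiteral y) ls
  go []             = refl
  go ((i , b) ∷ ls) = cong₂ _∨_ (evalLiteral-cong {x = x} {y} i b (x≗y i)) (go ls)

evalLiteral-true : ∀ {n} (x : Assignment n) i b → evalLiteral x (i , b) ≡ true → x i ≡ b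
evalLiteral-true x i true  eq = eq
evalLiteral-true x i false eq with x i
... | false = refl

evalLiteral-same : ∀ {n} (x : Assignment n) i b → x i ≡ b → evalLiteral x (i , b) ≡ true
evalLiteral-same x i true  eq = eq
evalLiteral-same x i false eq = cong not eq

evalLiteral-opposite : ∀ {n} (x : Assignment n) i b → x i ≡ not b → evalLiteral x (i , b) ≡ false
evalLiteral-opposite x i true  eq = eq
evalLiteral-opposite x i false eq = cong not eq

polarity-unique : ∀ {n} {ls : List (Literal n)} → Unique (map proj₁ ls) →
  ∀ {i b b′} → (i , b) ∈ ls → (i , b′) ∈ ls → b ≡ b′
polarity-unique _        (here refl) (here refl) = refl
polarity-unique (≢s ∷ _) (here refl) (there q)   = contradiction refl (All.lookup ≢s (∈-map⁺ proj₁ q))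
polarity-unique (≢s ∷ _) (there p)   (here refl) = contradiction refl (All.lookup ≢s (∈-map⁺ proj₁ p))
polarity-unique (_ ∷ us) (there p)   (there q)   = polarity-unique us p q

-- Probes

marked : (ℕ → ℕ) → ℕ → ℕ → Bool
marked f zero    c = false
marked f (suc d) c = (c ≡ᵇ f (suc d)) ∨ marked f d c

marked-cong : ∀ {f g} d → (∀ e → e ≤ d → f e ≡ g e) → ∀ c → marked f d c ≡ marked g d c
marked-cong zero    eq c = refl
marked-cong (suc d) eq c =
  cong₂ _∨_ (cong (c ≡ᵇ_) (eq (suc d) ≤-refl)) (marked-cong d (λ e → eq e ∘ m≤n⇒m≤1+n) c)

marked-complete : ∀ f {d} e → e < d → marked f d (f (suc e)) ≡ true
marked-complete f {suc d} e e<1+d with m≤n⇒m<n∨m≡n (s≤s⁻¹ e<1+d)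
... | inj₂ refl rewrite ≡ᵇ-refl (f (suc d)) = refl
... | inj₁ e<d with f (suc e) ≡ᵇ f (suc d)
...   | true  = refl
...   | false = marked-complete f e e<d

marked-sound : ∀ f d {c} → marked f d c ≡ true → ∃[ e ] (c ≡ f (suc e))
marked-sound f (suc d) {c} eq with c ≡ᵇ f (suc d) in hit
... | true  = d , ≡ᵇ-true hit
... | false = marked-sound f d eq

-- f 0 is the variable under test; f 1, …, f d are the other variables set to true.
probe : ∀ {n} → (ℕ → ℕ) → ℕ → Bool → Assignment n
probe f d b i = if toℕ i ≡ᵇ f 0 then b else marked f d (toℕ i)

probe-cong : ∀ {n f g} d → (∀ e → e ≤ d → f e ≡ g e) → ∀ b (i : Fin n) → probe f d b i ≡ probe g d b i
probe-cong d eq b i rewrite eq 0 z≤n | marked-cong d eq (toℕ i) = refl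

probe-tested : ∀ {n} f d b {i : Fin n} → toℕ i ≡ f 0 → probe f d b i ≡ b
probe-tested f d b {i} eq rewrite eq | ≡ᵇ-refl (f 0) = refl

probe-untested : ∀ {n} f d b {i : Fin n} → toℕ i ≢ f 0 → probe f d b i ≡ marked f d (toℕ i)
probe-untested f d b neq rewrite ≡ᵇ-false neq = refl

Reveals : ∀ {n} → (ℕ → ℕ) → ℕ → Bool → Clause n → Set
Reveals f d b C = evalClause (probe f d b) C ≡ true × evalClause (probe f d (not b)) C ≡ false

-- The two probes differ only at variable `f 0`. A literal that is true under the first probe and
-- sits on another variable would stay true under the second and satisfy `C` there. So it sits on
-- `f 0`, and being true it has sign `b`.
reveals-sound : ∀ {n} f d b (C : Clause n) {i} → toℕ i ≡ f 0 → Reveals f d b C → (i , b) ∈ literals C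
reveals-sound {n} f d b C {i} i≡ (yes-b , no-b)
  with any-witness (evalLiteral (probe f d b)) (literals C) yes-b
... | (i′ , b′) , l∈ , l-true with toℕ i′ ≟ f 0
...   | yes i′≡ = subst₂ (λ i b → (i , b) ∈ literals C) (toℕ-injective (trans i′≡ (sym i≡)))
                    (trans (sym (evalLiteral-true (probe f d b) i′ b′ l-true)) (probe-tested f d b i′≡)) l∈
...   | no i′≢  = contradiction
  (trans (sym no-b) (any-true (evalLiteral (probe f d (not b))) l∈ still-true)) λ ()
  where
  still-true : evalLiteral (probe f d (not b)) (i′ , b′) ≡ true
  still-true = trans
    (evalLiteral-cong {x = probe f d (not b)} {probe f d b} i′ b′
      (trans (probe-untested f d (not b) i′≢) (sym (probe-untested f d b i′≢))))
    l-true

nth : {A : Set} → A → List A → ℕ → A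
nth z []       e       = z
nth z (x ∷ xs) zero    = x
nth z (x ∷ xs) (suc e) = nth z xs e

nth-complete : ∀ {A : Set} (z : A) {x xs} → x ∈ xs → ∃[ e ] (e < length xs × nth z xs e ≡ x)
nth-complete z (here refl) = 0 , s≤s z≤n , refl
nth-complete z (there x∈) with nth-complete z x∈
... | e , e< , eq = suc e , s≤s e< , eq

nth-sound : ∀ {A : Set} (z : A) xs e → nth z xs e ≡ z ⊎ nth z xs e ∈ xs
nth-sound z []       e       = inj₁ refl
nth-sound z (x ∷ xs) zero    = inj₂ (here refl)
nth-sound z (x ∷ xs) (suc e) with nth-sound z xs e
... | inj₁ eq = inj₁ eq
... | inj₂ x∈ = inj₂ (there x∈)

-- Set exactly the negated variables of C other than i to true; padding the
-- tuple with i is harmless, because the value of i is overridden.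
reveals-complete : ∀ {n} d (C : Clause n) {i b} → length (literals C) ≤ suc d → (i , b) ∈ literals C →
  Σ[ u ∈ (ℕ → Fin n) ] (u 0 ≡ i × Reveals (toℕ ∘ u) d b C)
reveals-complete {n} d C {i} {b} len l∈ = u , refl , tested-true , any-false _ _ all-false
  where
  P : Literal n → Set
  P (i′ , b′) = i′ ≢ i × b′ ≡ false
  P? : Decidable P
  P? (i′ , b′) = ¬? (i′ ≟ᶠ i) ×-dec (b′ ≟ᴮ false)
  others : List (Fin n)
  others = map proj₁ (filter P? (literals C))
  -- The filter drops at least `(i , b)` itself, which turns the bound `suc d` into `d`.
  others-length : length others ≤ d
  others-length = ≤-trans (≤-reflexive (length-map proj₁ (filter P? (literals C))))
    (s≤s⁻¹ (≤-trans (filter-notAll P? (literals C) (lose l∈ λ (i≢i , _) → i≢i refl)) len))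
  u : ℕ → Fin n
  u zero    = i
  u (suc e) = nth i others e
  f : ℕ → ℕ
  f = toℕ ∘ u
  tested-true : evalClause (probe f d b) C ≡ true
  tested-true = any-true (evalLiteral (probe f d b)) l∈
    (evalLiteral-same (probe f d b) i b (probe-tested f d b refl))
  untested : ∀ {i′ b′} → i′ ≢ i → (i′ , b′) ∈ literals C → marked f d (toℕ i′) ≡ not b′
  untested {i′} {false} i′≢i l′∈
    with nth-complete i (∈-map⁺ proj₁ (∈-filter⁺ P? l′∈ (i′≢i , refl)))
  ... | e , e< , refl = marked-complete f e (<-≤-trans e< others-length)
  -- If the variable of a positive literal were set to true, it would be either the padding `i` or
  -- the variable of a negative literal of `C`; distinctness of variables excludes the latter.
  untested {i′} {true} i′≢i l′∈ = ¬-not λ hit → absurd (marked-sound f d hit)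
    where
    absurd : ¬ (∃[ e ] toℕ i′ ≡ f (suc e))
    absurd (e , eq) with nth-sound i others e
    ... | inj₁ pad = i′≢i (trans (toℕ-injective eq) pad)
    ... | inj₂ o∈ with ∈-map⁻ proj₁ o∈
    ...   | (i″ , b″) , l″∈ , eq′ with ∈-filter⁻ P? {xs = literals C} l″∈
    ...     | l″∈C , _ , refl with trans (toℕ-injective eq) eq′
    ...       | refl = contradiction (polarity-unique (distinct C) l′∈ l″∈C) λ ()
  all-false : ∀ {l} → l ∈ literals C → evalLiteral (probe f d (not b)) l ≡ false
  all-false {i′ , b′} l′∈ with i′ ≟ᶠ i
  ... | yes refl rewrite polarity-unique (distinct C) l′∈ l∈ =
    evalLiteral-opposite (probe f d (not b)) i b (probe-tested f d (not b) refl)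
  ... | no i′≢i = evalLiteral-opposite (probe f d (not b)) i′ b′
    (trans (probe-untested f d (not b) (i′≢i ∘ toℕ-injective)) (untested i′≢i l′∈))

-- The program

clauseVar : Var
clauseVar = 3

-- The offset skips `varN`, `varM`, `verdict` and `clauseVar`, so counters differ from these by
-- computation.
counter : ℕ → Var
counter e = 4 + e

memoTable : Table
memoTable = 4

mark : ℕ → ℕ → Program
mark v zero    = skip
mark v (suc d) = assignmentTable [ const 0 , var (counter (suc d)) ]≔ const v ⨾ mark v d

test : Bool → Program
test b = assignmentTable [ const 0 , var (counter 0) ]≔ const (bit b)
       ⨾ query
       ⨾ memoTable [ const 0 , const (bit b) ]≔ (answerTable [ const 0 , var clauseVar ])

-- A memo bit is 1 if the probe violated the clause. Strict inequality thus says that value `b`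
-- satisfies the clause and the opposite value violates it.
recordLiteral : Bool → Program
recordLiteral b =
  ifte (less (memoTable [ const 0 , const (bit b) ]) (memoTable [ const 0 , const (bit (not b)) ]))
       (literalTable b [ var clauseVar , var (counter 0) ]≔ const 1)
       skip

clear : ℕ → Program
clear d = assignmentTable [ const 0 , var (counter 0) ]≔ const 0 ⨾ mark 0 d

body : ℕ → Program
body d = mark 1 d ⨾ test false ⨾ test true ⨾ clear d ⨾ recordLiteral true ⨾ recordLiteral false

for : Var → Var → Program → Program
for x bound p = x ≔ const 0 ⨾ while (less (var x) (var bound)) (p ⨾ x ≔ inc (var x))

-- `nest d (suc d)` enumerates all tuples of `d + 1` variables, with `counter d` outermost and
-- `counter 0`, the tested variable, innermost.
nest : ℕ → ℕ → Program
nest d zero    = body d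
nest d (suc e) = for (counter e) varN (nest d e)

-- The guard serves the time bound: for `n = 0` and positive `k` the product `m * n ^ k` vanishes,
-- so even an idle loop over the clauses would be too slow.
learn : ℕ → Program
learn d = ifte (var varN) (for clauseVar varM (nest d (suc d))) skip

-- The summands are the times of marking, the two tests, clearing and the two recording steps,
-- bracketed as the sequence in `body`.
bodyTime : ℕ → ℕ
bodyTime d = suc (d * 4) + (11 + (11 + (4 + suc (d * 4) + (12 + 12))))

nestTime : ℕ → ℕ → ℕ → ℕ
nestTime n d zero    = bodyTime d
nestTime n d (suc e) = 6 + n * (7 + nestTime n d e)

Tables : Set
Tables = Table → ℕ → ℕ → ℕ

-- Running counting loops against the oracle of a fixed formula

module _ {n m} (φ : Formula n m) where

  Runs : Program → State → ℕ → (State → Set) → Set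
  Runs p σ B Q = ∃[ t ] ∃[ τ ] ((allViolated φ ⊢ p , σ ⇓[ t ] τ) × Q τ × t ≤ B)

  -- Hoare rule for `for`. By `stable` the invariant says nothing about the loop variable, so
  -- resetting and incrementing it is harmless; its value is tracked separately, and `step` has to
  -- show that the loop body restores it.
  module _ {x bound : Var} {p : Program} {N B : ℕ} (Inv : ℕ → State → Set)
    (stable  : ∀ {a v σ} → Inv a σ → Inv a (setVar x v σ))
    (bounded : ∀ {a σ} → Inv a σ → vars σ bound ≡ N)
    (step    : ∀ {a σ} → a < N → vars σ x ≡ a → Inv a σ →
               Runs p σ B λ τ → vars τ x ≡ a × Inv (suc a) τ)
    where

    guard : ∀ {a b c} σ → vars σ x ≡ a → Inv b σ → (a <ᵇ N) ≡ c →
      isSet (eval σ (less (var x) (var bound))) ≡ c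
    guard σ x≡ inv eq rewrite x≡ | bounded inv = trans (isSet-bit _) eq

    -- Induction on the number `r` of remaining rounds. Evaluating the guard costs 4 and the
    -- increment 3, whence 7 on top of `B` per round and 4 for the final failing guard.
    while-runs : ∀ r {a σ} → a + r ≡ N → vars σ x ≡ a → Inv a σ →
      Runs (while (less (var x) (var bound)) (p ⨾ x ≔ inc (var x))) σ (4 + r * (7 + B)) (Inv N)
    while-runs zero {a} {σ} eq x≡ inv with trans (sym (+-identityʳ a)) eq
    ... | refl = 4 , σ , ⇓stop (guard σ x≡ inv (<ᵇ-irrefl a)) , inv , ≤-refl
    while-runs (suc r) {a} {σ} eq x≡ inv
      with a<N ← ≤-trans (s≤s (m≤m+n a r)) (≤-reflexive (trans (sym (+-suc a r)) eq))
      with s , τ , run , (x≡′ , inv′) , s≤ ← step a<N x≡ inv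
         | eq′ ← trans (sym (+-suc a r)) eq
      with t , ρ , run′ , inv″ , t≤ ← while-runs r {σ = setVar x (suc (vars τ x)) τ} eq′
             (trans (setVar-same x (suc (vars τ x)) τ) (cong suc x≡′)) (stable inv′)
      = _ , ρ , ⇓loop (guard σ x≡ inv (<ᵇ-true a<N)) (⇓seq run ⇓var) run′ , inv″ , time
      where
      time : 4 + ((s + 3) + t) ≤ 4 + (7 + B + r * (7 + B))
      time = +-monoʳ-≤ 4 (begin
        s + 3 + t                  ≤⟨ +-mono-≤ (+-monoˡ-≤ 3 s≤) t≤ ⟩
        B + 3 + (4 + r * (7 + B))  ≡⟨ +-assoc (B + 3) 4 _ ⟨
        B + 3 + 4 + r * (7 + B)    ≡⟨ cong (_+ r * (7 + B)) (trans (+-assoc B 3 4) (+-comm B 7)) ⟩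
        7 + B + r * (7 + B)        ∎)
        where open ≤-Reasoning

    for-runs : ∀ {σ} → Inv 0 σ → Runs (for x bound p) σ (6 + N * (7 + B)) (Inv N)
    for-runs {σ} inv
      with t , τ , run , post , t≤ ← while-runs N refl (setVar-same x 0 σ) (stable inv)
      = _ , τ , ⇓seq ⇓var run , post , +-monoʳ-≤ 2 t≤

  -- The loop-free body, for fixed values of the variables

  module _ (g : Var → ℕ) where

    f : ℕ → ℕ
    f = g ∘ counter

    -- The body assigns to no variable, so `g` is a parameter and only the tables evolve.
    Rewrites : Program → Tables → ℕ → (Tables → Set) → Set
    Rewrites p T B Q =
      ∃[ t ] ∃[ T′ ] ((allViolated φ ⊢ p , mkState g T ⇓[ t ] mkState g T′) × Q T′ × t ≤ B)

    infixr 4 _▷_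
    _▷_ : ∀ {p q T B C Q R} → Rewrites p T B Q → (∀ {T′} → Q T′ → Rewrites q T′ C R) →
      Rewrites (p ⨾ q) T (B + C) R
    (s , T′ , run , post , s≤) ▷ continue with continue post
    ... | t , T″ , run′ , post′ , t≤ = s + t , T″ , ⇓seq run run′ , post′ , +-mono-≤ s≤ t≤

    -- This covers the literal tables and the memo. With the index in the form `2 + t`, lookups past
    -- a write to table 0 reduce by computation.
    SameFrom2 : Tables → Tables → Set
    SameFrom2 T T′ = ∀ t r c → T′ (2 + t) r c ≡ T (2 + t) r c

    mark-runs : ∀ v d {T} → Rewrites (mark v d) T (suc (d * 4)) λ T′ →
      (∀ c → T′ 0 0 c ≡ (if marked f d c then v else T 0 0 c)) × SameFrom2 T T′
    mark-runs v zero    = 1 , _ , ⇓skip , ((λ c → refl) , λ t r c → refl) , ≤-refl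
    mark-runs v (suc d) {T} with mark-runs v d {tables (setCell 0 0 (f (suc d)) v (mkState g T))}
    ... | t , T′ , run , (row , same) , t≤ =
      _ , T′ , ⇓seq ⇓cell run , (row′ , same) ,
      ≤-trans (+-monoʳ-≤ 4 t≤) (≤-reflexive (+-suc 4 (d * 4)))
      where
      row′ : ∀ c → T′ 0 0 c ≡ (if marked f (suc d) c then v else T 0 0 c)
      row′ c with c ≡ᵇ f (suc d) | marked f d c | row c
      ... | true  | true  | eq = eq
      ... | true  | false | eq = eq
      ... | false | true  | eq = eq
      ... | false | false | eq = eq

    answer-bit : ∀ x (j : Fin m) {v} → toℕ j ≡ v →
      memberBit (allViolated φ x) v ≡ bit (not (evalClause x (φ j)))
    answer-bit x j refl with toℕ j <? m
    ... | yes j<m = cong bit (trans (lookup∘tabulate (λ j → not (evalClause x (φ j))) (fromℕ< j<m))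
                                    (cong (λ j → not (evalClause x (φ j))) (fromℕ<-toℕ j j<m)))
    ... | no  j≮m = contradiction (toℕ<n j) j≮m

    -- The trivial first branch leaves the tested entry unconstrained, so that
    -- consecutive tests need not reset it.
    Marked : ℕ → Tables → Set
    Marked d T = ∀ c → T 0 0 c ≡ (if c ≡ᵇ f 0 then T 0 0 c else bit (marked f d c))

    -- In the queried row only the tested entry changes, and `Marked` leaves that entry free, so a
    -- second test can follow at once. The answer is copied to the memo because the next query
    -- overwrites it; the memo bit of the opposite value survives.
    test-runs : ∀ b d {T} → Marked d T → Rewrites (test b) T 11 λ T′ →
        Marked d T′
      × (∀ j → toℕ j ≡ g clauseVar → T′ 4 0 (bit b) ≡ bit (not (evalClause (probe f d b) (φ j))))
      × (T′ 4 0 (bit (not b)) ≡ T 4 0 (bit (not b)))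
      × (∀ b r c → T′ (literalTable b) r c ≡ T (literalTable b) r c)
    test-runs b d {T} marks = _ , _ , ⇓seq ⇓cell (⇓seq ⇓query ⇓cell) ,
      ( marks′
      , (λ j j≡ → trans (written b) (trans (answer-bit x j j≡)
          (cong (bit ∘ not) (evalClause-cong (φ j) x≗probe))))
      , kept b
      , λ { true r c → refl ; false r c → refl }) , ≤-refl
      where
      x : Assignment n
      x i = isSet (if toℕ i ≡ᵇ f 0 then bit b else T 0 0 (toℕ i))
      x≗probe : ∀ i → x i ≡ probe f d b i
      x≗probe i with toℕ i ≡ᵇ f 0 | marks (toℕ i)
      ... | true  | _  = isSet-bit b
      ... | false | eq = trans (cong isSet eq) (isSet-bit (marked f d (toℕ i)))
      marks′ : ∀ c → (if c ≡ᵇ f 0 then bit b else T 0 0 c) ≡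
        (if c ≡ᵇ f 0 then (if c ≡ᵇ f 0 then bit b else T 0 0 c) else bit (marked f d c))
      marks′ c with c ≡ᵇ f 0 | marks c
      ... | true  | _  = refl
      ... | false | eq = eq
      written : ∀ b {A : Set} {x y : A} → (if bit b ≡ᵇ bit b then x else y) ≡ x
      written true  = refl
      written false = refl
      kept : ∀ b {A : Set} {x y : A} → (if bit (not b) ≡ᵇ bit b then x else y) ≡ y
      kept true  = refl
      kept false = refl

    -- By `Marked` a nonzero entry can occur only at `f 0`, ..., `f d`. Resetting these cells
    -- therefore empties the whole row, in time independent of `n`.
    clear-runs : ∀ d {T} → Marked d T → Rewrites (clear d) T (4 + suc (d * 4)) λ T′ →
      (∀ c → T′ 0 0 c ≡ 0) × SameFrom2 T T′
    clear-runs d {T} marks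
      with t , T′ , run , (row , same) , t≤
        ← mark-runs 0 d {tables (setCell 0 0 (f 0) 0 (mkState g T))}
      = _ , T′ , ⇓seq ⇓cell run , ((λ c → trans (row c) (cleared c)) , same) , +-monoʳ-≤ 4 t≤
      where
      cleared : ∀ c → (if marked f d c then 0 else (if c ≡ᵇ f 0 then 0 else T 0 0 c)) ≡ 0
      cleared c with marked f d c | c ≡ᵇ f 0 | marks c
      ... | true  | _     | _  = refl
      ... | false | true  | _  = refl
      ... | false | false | eq = eq

    fired : Tables → Bool → Bool
    fired T b = T 4 0 (bit b) <ᵇ T 4 0 (bit (not b))

    record-runs : ∀ b {T} → Rewrites (recordLiteral b) T 12 λ T′ →
        (∀ c → T′ 0 0 c ≡ T 0 0 c)
      × (∀ c → T′ 4 0 c ≡ T 4 0 c)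
      × (∀ r c → T′ (literalTable (not b)) r c ≡ T (literalTable (not b)) r c)
      × (∀ r c → T′ (literalTable b) r c ≡
          (if fired T b ∧ (r ≡ᵇ g clauseVar) ∧ (c ≡ᵇ f 0) then 1 else T (literalTable b) r c))
    record-runs b {T} with fired T b in eq
    ... | false = _ , _ , ⇓else (trans (isSet-bit _) eq) ⇓skip ,
          ((λ c → refl) , (λ c → refl) , (λ r c → refl) , λ r c → refl) , m≤m+n 9 3
    -- `literalTable b` reduces only for a concrete `b`; after the split every table comparison
    -- computes.
    record-runs true {T} | true = _ , _ , ⇓then (trans (isSet-bit _) eq) ⇓cell ,
          ((λ c → refl) , (λ c → refl) , (λ r c → refl) , λ r c → refl) , ≤-refl
    record-runs false {T} | true = _ , _ , ⇓then (trans (isSet-bit _) eq) ⇓cell ,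
          ((λ c → refl) , (λ c → refl) , (λ r c → refl) , λ r c → refl) , ≤-refl

    comparison : ℕ → Fin m → Bool → Bool
    comparison d j b = bit (not (evalClause (probe f d b) (φ j)))
                    <ᵇ bit (not (evalClause (probe f d (not b)) (φ j)))

    -- The number in `clauseVar` is not yet known to be a clause index, so `fires` is tied to the
    -- formula only through `fires-≡`.
    record CellUpdate (d : ℕ) (T T′ : Tables) : Set where
      constructor mkCellUpdate
      field
        blank   : ∀ c → T′ 0 0 c ≡ 0
        fires   : Bool → Bool
        fires-≡ : ∀ j → toℕ j ≡ g clauseVar → ∀ b → fires b ≡ comparison d j b
        cells   : ∀ b r c → T′ (literalTable b) r c ≡
          (if fires b ∧ (r ≡ᵇ g clauseVar) ∧ (c ≡ᵇ f 0) then 1 else T (literalTable b) r c)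

    body-runs : ∀ d {T} → (∀ c → T 0 0 c ≡ 0) → Rewrites (body d) T (bodyTime d) (CellUpdate d T)
    body-runs d {T} blank =
      mark-runs 1 d ▷ λ {T₁} (row₁ , same₁) →
      test-runs false d (marks₁ T₁ row₁) ▷ λ {T₂} (marks₂ , answer₂ , _ , lits₂) →
      test-runs true d marks₂ ▷ λ {T₃} (marks₃ , answer₃ , memo₃ , lits₃) →
      clear-runs d marks₃ ▷ λ {T₄} (blank₄ , same₄) →
      record-runs true ▷ λ {T₅} (row₅ , memo₅ , other₅ , lits₅) →
      weaken (record-runs false) λ {T₆} (row₆ , memo₆ , other₆ , lits₆) → mkCellUpdate
        (λ c → trans (row₆ c) (trans (row₅ c) (blank₄ c)))
        (fired T₄)
        (λ j j≡ →
          let memo-true  = trans (same₄ 2 0 1) (answer₃ j j≡)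
              memo-false = trans (same₄ 2 0 0) (trans memo₃ (answer₂ j j≡))
          in λ { true → cong₂ _<ᵇ_ memo-true memo-false ; false → cong₂ _<ᵇ_ memo-false memo-true })
        (let lits₄ : ∀ b r c → T₄ (literalTable b) r c ≡ T (literalTable b) r c
             lits₄ = λ b r c → trans (sameLits T₃ T₄ same₄ b r c) (trans (lits₃ b r c)
                       (trans (lits₂ b r c) (sameLits T T₁ same₁ b r c)))
         in λ { true r c → trans (other₆ r c) (trans (lits₅ r c)
                  (cong (if fired T₄ true ∧ (r ≡ᵇ g clauseVar) ∧ (c ≡ᵇ f 0) then 1 else_) (lits₄ true r c)))
              -- The second recording step reads the memo after the first one; `memo₅` says that the
              -- memo is still the one in `T₄`.
              ; false r c → trans (lits₆ r c)
                  (cong₂ (λ fires → if fires ∧ (r ≡ᵇ g clauseVar) ∧ (c ≡ᵇ f 0) then 1 else_)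
                    (cong₂ _<ᵇ_ (memo₅ 0) (memo₅ 1))
                    (trans (other₅ r c) (lits₄ false r c))) })
      where
      weaken : ∀ {p T B} {Q R : Tables → Set} → Rewrites p T B Q → (∀ {T′} → Q T′ → R T′) → Rewrites p T B R
      weaken (t , T′ , run , post , t≤) h = t , T′ , run , h post , t≤
      sameLits : ∀ T T′ → SameFrom2 T T′ → ∀ b r c → T′ (literalTable b) r c ≡ T (literalTable b) r c
      sameLits T T′ same true  = same 0
      sameLits T T′ same false = same 1
      marks₁ : ∀ T₁ → (∀ c → T₁ 0 0 c ≡ (if marked f d c then 1 else T 0 0 c)) → Marked d T₁
      marks₁ T₁ row c with c ≡ᵇ f 0 | marked f d c | row c
      ... | true  | _     | _  = refl
      ... | false | true  | eq = eq
      ... | false | false | eq = trans eq (blank c)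

  -- The nested loops over tuples of variables

  LiteralBit : Bool → Fin m → Fin n → State → Set
  LiteralBit b j i σ = isSet (tables σ (literalTable b) (toℕ j) (toℕ i)) ≡ true

  infix 4 _⊑_
  _⊑_ : State → State → Set
  σ ⊑ τ = ∀ b j i → LiteralBit b j i σ → LiteralBit b j i τ

  record Ready (σ : State) : Set where
    constructor mkReady
    field
      size  : vars σ varN ≡ n
      blank : ∀ c → tables σ 0 0 c ≡ 0
      sound : ∀ b j i → LiteralBit b j i σ → (i , b) ∈ literals (φ j)
  open Ready

  Detected : ℕ → ℕ → (ℕ → ℕ) → State → Set
  Detected d v f σ = ∀ b j i → toℕ j ≡ v → toℕ i ≡ f 0 → Reveals f d b (φ j) → LiteralBit b j i σ

  Kept : ℕ → State → State → Set
  Kept e σ τ = ∀ y → (∀ e′ → e′ < e → y ≢ counter e′) → vars τ y ≡ vars σ y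

  -- Inside `nest d e` the enclosing loops have fixed the counters from `e` to `d`, while those
  -- below `e` still run; only the former are compared.
  Agrees : ℕ → ℕ → State → (ℕ → ℕ) → Set
  Agrees d e σ f = ∀ e′ → e ≤ e′ → e′ ≤ d → f e′ ≡ vars σ (counter e′)

  detected-cong : ∀ d {v f g σ} → (∀ e → e ≤ d → f e ≡ g e) → Detected d v g σ → Detected d v f σ
  detected-cong d {f = f} {g} f≗g det b j i j≡ i≡ (yes-b , no-b) =
    det b j i j≡ (trans i≡ (f≗g 0 z≤n))
      ( trans (evalClause-cong (φ j) (λ i → sym (probe-cong d f≗g b i))) yes-b
      , trans (evalClause-cong (φ j) (λ i → sym (probe-cong d f≗g (not b) i))) no-b )

  -- The last component is completeness: every tuple that extends the fixed counters has been tried.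
  -- Tuples are functions on all numbers, of which only the entries up to `d` enter a probe.
  Post : ℕ → ℕ → State → State → Set
  Post d e σ τ = Ready τ × Kept e σ τ × σ ⊑ τ ×
    (∀ f → Agrees d e σ f → (∀ e → f e < n) → Detected d (vars σ clauseVar) f τ)

  -- Literal cells are only ever overwritten by 1, which gives monotonicity. A new 1 comes from a
  -- successful comparison and is justified by `reveals-sound`; conversely, a revealing tuple makes
  -- the comparison succeed.
  cellUpdate-post : ∀ d {σ T} → Ready σ → CellUpdate (vars σ) d (tables σ) T →
    Post d 0 σ (mkState (vars σ) T)
  cellUpdate-post d {σ} {T} ready update =
    mkReady (size ready) (CellUpdate.blank update) sound′ , (λ y _ → refl) , mono , detects
    where
    open CellUpdate update using (fires; fires-≡; cells)
    τ : State
    τ = mkState (vars σ) T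
    h : ℕ → ℕ
    h e = vars σ (counter e)
    mono : σ ⊑ τ
    mono b j i set rewrite cells b (toℕ j) (toℕ i)
      with fires b ∧ (toℕ j ≡ᵇ vars σ clauseVar) ∧ (toℕ i ≡ᵇ h 0)
    ... | true  = refl
    ... | false = set
    comparison-true : ∀ p q → (bit (not p) <ᵇ bit (not q)) ≡ true → p ≡ true × q ≡ false
    comparison-true true false _ = refl , refl
    sound′ : ∀ b j i → LiteralBit b j i τ → (i , b) ∈ literals (φ j)
    sound′ b j i set rewrite cells b (toℕ j) (toℕ i)
      with fires b in fire | toℕ j ≡ᵇ vars σ clauseVar in j≡ | toℕ i ≡ᵇ h 0 in i≡
    ... | true  | true  | true  = reveals-sound h d b (φ j) (≡ᵇ-true i≡)
          (comparison-true _ _ (trans (sym (fires-≡ j (≡ᵇ-true j≡) b)) fire))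
    ... | true  | true  | false = sound ready b j i set
    ... | true  | false | _     = sound ready b j i set
    ... | false | _     | _     = sound ready b j i set
    detects′ : Detected d (vars σ clauseVar) h τ
    detects′ b j i j≡ i≡ (yes-b , no-b)
      rewrite cells b (toℕ j) (toℕ i) | fires-≡ j j≡ b | yes-b | no-b
            | j≡ | i≡ | ≡ᵇ-refl (vars σ clauseVar) | ≡ᵇ-refl (h 0) = refl
    detects : ∀ f → Agrees d 0 σ f → (∀ e → f e < n) → Detected d (vars σ clauseVar) f τ
    detects f agrees _ = detected-cong d {σ = τ} (λ e → agrees e z≤n) detects′

  body-learns : ∀ d {σ} → Ready σ → Runs (body d) σ (bodyTime d) (Post d 0 σ)
  body-learns d {σ} ready = let t , T , run , update , t≤ = body-runs (vars σ) d {tables σ} (blank ready) in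
    t , mkState (vars σ) T , run , cellUpdate-post d ready update , t≤

  -- As `varN` is 0, the successor pattern makes its preservation hold by computation.
  setVar-ready : ∀ {σ} x {v} → Ready σ → Ready (setVar (suc x) v σ)
  setVar-ready x (mkReady size blank sound) = mkReady size blank sound

  -- Induction on the depth. The loop invariant is the postcondition with completeness restricted to
  -- tuples with `f e < a`; at `a = n` the restriction is void.
  nest-learns : ∀ d e {σ} → Ready σ → Runs (nest d e) σ (nestTime n d e) (Post d e σ)
  nest-learns d zero    ready = body-learns d ready
  nest-learns d (suc e) {σ} ready =
    weaken (for-runs Inv stable (λ inv → size (proj₁ inv)) step
      (ready , (λ y _ → refl) , (λ b j i set → set) , λ f _ _ ()))
    where
    Inv : ℕ → State → Set
    Inv a τ = Ready τ × Kept (suc e) σ τ × σ ⊑ τ ×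
      (∀ f → Agrees d (suc e) σ f → (∀ e → f e < n) → f e < a → Detected d (vars σ clauseVar) f τ)
    weaken : ∀ {B} → Runs (nest d (suc e)) σ B (Inv n) → Runs (nest d (suc e)) σ B (Post d (suc e) σ)
    weaken (t , τ , run , (ready′ , kept , mono , det) , t≤) =
      t , τ , run , (ready′ , kept , mono , λ f agrees f<n → det f agrees f<n (f<n e)) , t≤
    stable : ∀ {a v τ} → Inv a τ → Inv a (setVar (counter e) v τ)
    stable {v = v} {τ} (ready′ , kept , mono , det) =
      setVar-ready _ ready′ ,
      (λ y y≢ → trans (setVar-other v τ (y≢ e ≤-refl)) (kept y y≢)) ,
      mono , det
    step : ∀ {a τ} → a < n → vars τ (counter e) ≡ a → Inv a τ →
      Runs (nest d e) τ (nestTime n d e) λ τ′ → vars τ′ (counter e) ≡ a × Inv (suc a) τ′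
    step {a} {τ} a<n count (ready′ , kept , mono , det) with nest-learns d e ready′
    ... | t , τ′ , run , (ready″ , kept′ , mono′ , det′) , t≤ =
      t , τ′ , run , (trans (kept′ (counter e) current) count ,
        ready″ , (λ y y≢ → trans (kept′ y (λ e′ → y≢ e′ ∘ m≤n⇒m≤1+n)) (kept y y≢)) ,
        (λ b j i → mono′ b j i ∘ mono b j i) , det″) , t≤
      where
      current : ∀ e′ → e′ < e → counter e ≢ counter e′
      current e′ e′<e eq = <⇒≢ e′<e (sym (+-cancelˡ-≡ 4 e e′ eq))
      det″ : ∀ f → Agrees d (suc e) σ f → (∀ e → f e < n) → f e < suc a →
        Detected d (vars σ clauseVar) f τ′
      det″ f agrees f<n fe<1+a with m≤n⇒m<n∨m≡n (s≤s⁻¹ fe<1+a)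
      ... | inj₁ fe<a = λ b j i j≡ i≡ reveals → mono′ b j i (det f agrees f<n fe<a b j i j≡ i≡ reveals)
      -- The tuples new in this round have `f e = a`, the current value of `counter e`. Earlier
      -- rounds left the higher counters alone, so such tuples agree with the inner loop's counters
      -- from `e` on.
      ... | inj₂ fe≡a = subst (λ v → Detected d v f τ′) (kept clauseVar λ _ _ ()) (det′ f agrees′ f<n)
        where
        agrees′ : Agrees d e τ f
        agrees′ e′ e≤e′ e′≤d with m≤n⇒m<n∨m≡n e≤e′
        ... | inj₂ refl = trans fe≡a (sym count)
        ... | inj₁ e<e′ = trans (agrees e′ e<e′ e′≤d)
          (sym (kept (counter e′) λ e″ e″<1+e eq →
            <⇒≢ (<-≤-trans e″<1+e e<e′) (sym (+-cancelˡ-≡ 4 e′ e″ eq))))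

  -- The loop over the clauses

  LearnedClause : ℕ → State → Set
  LearnedClause v σ = ∀ b j i → toℕ j ≡ v → (i , b) ∈ literals (φ j) → LiteralBit b j i σ

  clauses-learned : ∀ d → IsKSAT (suc d) φ →
    Runs (for clauseVar varM (nest d (suc d))) (initial n m) (6 + m * (7 + nestTime n d (suc d)))
      λ τ → vars τ verdict ≡ 0 × Learned φ τ
  clauses-learned d short = weaken (for-runs Inv stable (λ inv → proj₁ (proj₂ inv)) step
      (mkReady refl (λ _ → refl) (λ { true j i () ; false j i () }) , refl , refl , λ v ()))
    where
    Inv : ℕ → State → Set
    Inv a τ = Ready τ × vars τ varM ≡ m × vars τ verdict ≡ 0 × (∀ v → v < a → LearnedClause v τ)
    weaken : ∀ {p B} → Runs p (initial n m) B (Inv m) →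
      Runs p (initial n m) B λ τ → vars τ verdict ≡ 0 × Learned φ τ
    weaken (t , τ , run , (ready , _ , verdict≡ , done) , t≤) = t , τ , run ,
      (verdict≡ , λ j i b → mk⇔ (sound ready b j i) (done (toℕ j) (toℕ<n j) b j i refl)) , t≤
    stable : ∀ {a v τ} → Inv a τ → Inv a (setVar clauseVar v τ)
    stable (ready , m≡ , verdict≡ , done) = setVar-ready _ ready , m≡ , verdict≡ , done
    step : ∀ {a τ} → a < m → vars τ clauseVar ≡ a → Inv a τ →
      Runs (nest d (suc d)) τ (nestTime n d (suc d)) λ τ′ → vars τ′ clauseVar ≡ a × Inv (suc a) τ′
    step {a} {τ} a<m count (ready , m≡ , verdict≡ , done) with nest-learns d (suc d) ready
    ... | t , τ′ , run , (ready′ , kept , mono , det) , t≤ =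
      t , τ′ , run , (trans (kept clauseVar λ _ _ ()) count , ready′ ,
        trans (kept varM λ _ _ ()) m≡ , trans (kept verdict λ _ _ ()) verdict≡ , done′) , t≤
      where
      done′ : ∀ v → v < suc a → LearnedClause v τ′
      done′ v v<1+a b j i j≡ l∈ with m≤n⇒m<n∨m≡n (s≤s⁻¹ v<1+a)
      ... | inj₁ v<a = mono b j i (done v v<a b j i j≡ l∈)
      ... | inj₂ v≡a with reveals-complete d (φ j) (short j) l∈
      -- At full depth no counter is fixed in advance: `Agrees` would need an index above `d` and at
      -- most `d`. Hence the revealing tuple `u` is among those tried.
      ...   | u , u0≡ , reveals = det (toℕ ∘ u) (λ e d<e e≤d → contradiction d<e (≤⇒≯ e≤d)) (toℕ<n ∘ u)
              b j i (trans j≡ (trans v≡a (sym count))) (cong toℕ (sym u0≡)) reveals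

-- The time bound

nestConstant : ℕ → ℕ → ℕ
nestConstant d zero    = bodyTime d
nestConstant d (suc e) = 13 + nestConstant d e

-- Since the number of variables is positive, its powers absorb the additive constants 6 and 7 of
-- each loop level; hence the increment 13 in `nestConstant`.
nestTime-bound : ∀ n d e → nestTime (suc n) d e ≤ nestConstant d e * suc n ^ e
nestTime-bound n d zero    = ≤-reflexive (sym (*-identityʳ (bodyTime d)))
nestTime-bound n d (suc e) = begin
  6 + N * (7 + nestTime N d e)          ≤⟨ +-mono-≤ (m≤m*n 6 (N ^ suc e))
                                             (*-monoʳ-≤ N (+-mono-≤ (m≤m*n 7 (N ^ e)) (nestTime-bound n d e))) ⟩
  6 * N ^ suc e + N * (7 * N ^ e + C * N ^ e)  ≡⟨ solve 3 (λ N P C →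
    con 6 :* (N :* P) :+ N :* (con 7 :* P :+ C :* P) := (con 13 :+ C) :* (N :* P)) refl N (N ^ e) C ⟩
  (13 + C) * N ^ suc e                  ∎
  where
  open ≤-Reasoning
  open +-*-Solver
  N = suc n
  C = nestConstant d e
  instance
    _ = m^n≢0 N e
    _ = m^n≢0 N (suc e)

-- The guard costs 2 and the start and end of the clause loop 6; with the 7 per clause this gives
-- 15. The successor in the bound pays for the fixed cost when `m = 0`.
learn-time : ∀ n m d → 2 + (6 + m * (7 + nestTime (suc n) d (suc d))) ≤
  (15 + nestConstant d (suc d)) * suc (m * suc n ^ suc d)
learn-time n m d = begin
  8 + m * (7 + nestTime (suc n) d (suc d))  ≤⟨ +-monoʳ-≤ 8 (*-monoʳ-≤ m (+-mono-≤ (m≤m*n 7 P) (nestTime-bound n d (suc d)))) ⟩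
  -- The slack added here is exactly the difference to the target, which leaves a ring identity.
  8 + m * (7 * P + C * P)                   ≤⟨ m≤m+n _ _ ⟩
  8 + m * (7 * P + C * P) + (7 + C + 8 * (m * P))  ≡⟨ solve 3 (λ m P C →
    con 8 :+ m :* (con 7 :* P :+ C :* P) :+ (con 7 :+ C :+ con 8 :* (m :* P)) := (con 15 :+ C) :* (con 1 :+ m :* P)) refl m P C ⟩
  (15 + C) * suc (m * P)                    ∎
  where
  open ≤-Reasoning
  open +-*-Solver
  P = suc n ^ suc d
  C = nestConstant d (suc d)
  instance _ = m^n≢0 (suc n) (suc d)

theorem1 : (k : ℕ) → 1 ≤ k →
    Σ[ p ∈ Program ] Σ[ c ∈ ℕ ]
    ((n m : ℕ) (φ : Formula n m) → IsKSAT k φ →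
    ∃[ t ] ∃[ τ ]
    ((allViolated φ ⊢ p , initial n m ⇓[ t ] τ)
    × LearnsOrSatisfies φ τ
    × (t ≤ c * suc (m * n ^ k))))
theorem1 (suc d) _ = learn d , 15 + nestConstant d (suc d) , correct
  where
  correct : (n m : ℕ) (φ : Formula n m) → IsKSAT (suc d) φ →
    ∃[ t ] ∃[ τ ]
    ((allViolated φ ⊢ learn d , initial n m ⇓[ t ] τ)
    × LearnsOrSatisfies φ τ
    × (t ≤ (15 + nestConstant d (suc d)) * suc (m * n ^ suc d)))
  correct zero m φ short =
    -- Without variables there are no literals, so the untouched tables are correct; the guard takes
    -- 2 and `skip` takes 1.
    3 , initial 0 m , ⇓else refl ⇓skip , inj₁ (refl , λ j ()) ,
    ≤-trans (m≤m+n 3 (12 + nestConstant d (suc d))) (m≤m*n _ (suc (m * 0 ^ suc d)))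
  correct (suc n) m φ short with clauses-learned φ d short
  ... | t , τ , run , learned , t≤ =
    2 + t , τ , ⇓then refl run , inj₁ learned , ≤-trans (+-monoʳ-≤ 2 t≤) (learn-time n m d)
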